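{- Let $G_{2,5}$ be a regular $2$-balanced $5$-partite tournament with partite sets $V_{i} = \{v_{i,1}, v_{i,2} \}, i\in [5]$. If $G_{2,5}$ has no strong partition, then there is a partite set $V_i$ such that $V_j$ controls-2 $V_i$ for all $j \in [5]\setminus \{i\}$. Furthermore, the other four partite sets pairwise control-1 each other.
   Context: $G_{2,5}$ is an orientation of the complete $5$-partite graph with all partite sets of size $2$, and regular means $d^+(v)=d^-(v)$ for every vertex. A strong partition is a partition of the vertex set into two vertex-disjoint tournaments of order $5$ (each containing one vertex of every partite set) that are both strongly connected. For distinct partite sets $V_i,V_j$: $V_i$ controls-1 $V_j$ if there are exactly two arcs from $V_i$ to $V_j$ and $|N^{+}(v_{i,1}) \cap V_j| = |N^{+}(v_{i,2}) \cap V_j| = |N^{+}(v_{j,1}) \cap V_i| = |N^{+}(v_{j,2}) \cap V_i| = 1$; $V_j$ controls-2 $V_i$ if there are exactly two arcs from $V_j$ to $V_i$ and $|N^{+}(v_{i,1}) \cap V_j| \neq 1$, $|N^{+}(v_{i,2}) \cap V_j| \neq 1$. -}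

module Defs where

open import Data.Nat using (ℕ; _+_)
open import Data.Bool using (Bool; true; false; T; not)
open import Data.Fin using (Fin; zero; suc)
open import Data.List using (map; allFin)
open import Data.Nat.ListAction using (sum)
open import Data.Product using (_×_; ∃)
open import Relation.Binary.PropositionalEquality using (_≡_; _≢_)

-- Vertices of G_{2,5}: v_{i,a} is represented by (i , a) with i : Fin 5 (partite set)
-- and a : Fin 2 (index within the partite set).  A digraph on these vertices is given
-- by its arc-indicator  D i a j b = true  iff there is an arc v_{i,a} → v_{j,b}.
Digraph : Set
Digraph = Fin 5 → Fin 2 → Fin 5 → Fin 2 → Bool

IsMultipartiteTournament : Digraph → Set
IsMultipartiteTournament D =
  (∀ i a b → D i a i b ≡ false) ×
  (∀ i a j b → i ≢ j → D j b i a ≡ not (D i a j b))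

b2n : Bool → ℕ
b2n true  = 1
b2n false = 0

outIn : Digraph → Fin 5 → Fin 2 → Fin 5 → ℕ
outIn D i a j = sum (map (λ b → b2n (D i a j b)) (allFin 2))

inFrom : Digraph → Fin 5 → Fin 2 → Fin 5 → ℕ
inFrom D i a j = sum (map (λ b → b2n (D j b i a)) (allFin 2))

outDeg : Digraph → Fin 5 → Fin 2 → ℕ
outDeg D i a = sum (map (outIn D i a) (allFin 5))

inDeg : Digraph → Fin 5 → Fin 2 → ℕ
inDeg D i a = sum (map (inFrom D i a) (allFin 5))

IsRegular : Digraph → Set
IsRegular D = ∀ i a → outDeg D i a ≡ inDeg D i a

arcsFrom : Digraph → Fin 5 → Fin 5 → ℕ
arcsFrom D i j = sum (map (λ a → outIn D i a j) (allFin 2))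

data Reach (E : Fin 5 → Fin 5 → Bool) : Fin 5 → Fin 5 → Set where
  here : ∀ {x} → Reach E x x
  step : ∀ {x y z} → T (E x y) → Reach E y z → Reach E x z

StronglyConnected : (Fin 5 → Fin 5 → Bool) → Set
StronglyConnected E = ∀ x y → Reach E x y

flip2 : Fin 2 → Fin 2
flip2 zero = suc zero
flip2 (suc _) = zero

induced : Digraph → (Fin 5 → Fin 2) → Fin 5 → Fin 5 → Bool
induced D c i j = D i (c i) j (c j)

-- A partition of V(G_{2,5}) into two tournaments of order 5, each containing one vertex
-- of every partite set, is given by a choice c : Fin 5 → Fin 2 (first part
-- {v_{i,c i}}, second part {v_{i, flip2 (c i)}}).  It is strong if both are strong.
HasStrongPartition : Digraph → Set
HasStrongPartition D =
  ∃ λ (c : Fin 5 → Fin 2) →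
    StronglyConnected (induced D c) × StronglyConnected (induced D (λ i → flip2 (c i)))

Controls1 : Digraph → Fin 5 → Fin 5 → Set
Controls1 D i j =
  arcsFrom D i j ≡ 2 ×
  outIn D i zero j ≡ 1 × outIn D i (suc zero) j ≡ 1 ×
  outIn D j zero i ≡ 1 × outIn D j (suc zero) i ≡ 1

Controls2 : Digraph → Fin 5 → Fin 5 → Set
Controls2 D j i =
  arcsFrom D j i ≡ 2 ×
  outIn D i zero j ≢ 1 × outIn D i (suc zero) j ≢ 1

{-# OPTIONS --safe #-}

-- The proof is an exhaustive search with a verified search procedure.  Relabelling the
-- partite sets 2, …, 5 and the vertices inside them turns the out-neighbourhood of v_{1,1}
-- into one of three patterns, because v_{1,1} has out-degree 4.  From there the search
-- orients one unknown arc at a time, in both ways.  For each partition into two tournaments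
-- in turn it grows the set of vertices reachable from, and reaching, a root, branching on
-- undecided arcs that leave the set: either both tournaments become strong, which closes the
-- branch, or a cut shows that the partition is not strong.  A branch also closes when a
-- vertex has more than 4 out-neighbours or more than 4 in-neighbours.  Once every partition
-- has been cut, the digraph is completely known and the conclusion is read off.

module Submission where

open import Defs

open import Data.Bool using (Bool; true; false; not; _∧_; T; if_then_else_)
open import Data.Bool.Properties using (T-∧; T?)
open import Data.Empty using (⊥; ⊥-elim)
open import Data.Fin using (Fin; zero; suc; toℕ; combine; quotient; remainder; remQuot; _≟_)
open import Data.Fin.Patterns using (0F; 1F; 2F; 3F)
open import Data.Fin.Permutation as Perm using
  (Permutation′; _⟨$⟩ʳ_; _⟨$⟩ˡ_; inverseˡ; inverseʳ; lift₀; transpose; _∘ₚ_)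
open import Data.Fin.Properties using (all?; any?; combine-injectiveˡ; remQuot-combine)
open import Data.List using (List; []; _∷_; map; allFin; cartesianProduct; tabulate)
open import Data.List.Relation.Binary.Permutation.Propositional using (_↭_; ↭-refl; ↭-sym; ↭-trans; prep; swap)
open import Data.List.Relation.Binary.Permutation.Propositional.Properties using (All-resp-↭)
open import Data.List.Relation.Unary.All as All using (All; []; _∷_)
open import Data.List.Relation.Unary.All.Properties using (tabulate⁺; tabulate⁻) renaming (map⁺ to All-map⁺)
open import Data.List.Relation.Unary.Any as Any using (Any; here; there)
open import Data.Maybe using (Maybe; just; nothing; is-just; fromMaybe)
open import Data.Nat using (ℕ; zero; suc; _+_; _*_; _≤_; _<ᵇ_; s≤s⁻¹) renaming (_≟_ to _≟ℕ_)
open import Data.Nat.Properties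
  using (+-0-commutativeMonoid; +-comm; +-assoc; +-suc; +-identityʳ; +-cancelʳ-≡; ≤-reflexive; m+n≤o⇒n≤o; *-cancelˡ-≡)
open import Data.Product using (∃; ∃₂; Σ-syntax; _×_; _,_; proj₁; proj₂)
open import Data.Unit using (tt)
open import Data.Vec as Vec using (Vec; []; _∷_; lookup; updateAt)
open import Data.Vec.Properties using (lookup∘tabulate)
open import Function using (_∘_; Equivalence)
open import Level using (Lift; lift)
open import Relation.Binary.PropositionalEquality
  using (_≡_; _≢_; refl; sym; trans; cong; cong₂; subst; subst₂; module ≡-Reasoning)
open import Relation.Nullary using (¬_; Dec; yes; no; does)
open import Relation.Nullary.Decidable using (_×-dec_; _→-dec_; ¬?; isYes; toWitness)
open import Algebra.Properties.CommutativeMonoid.Sum +-0-commutativeMonoid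
  using (sum; sum-permute; sum-cong-≗; ∑-distrib-+)

-- Decidability of the conclusion.

Conclusion : Digraph → Set
Conclusion D = ∃ λ (i : Fin 5) →
  (∀ j → j ≢ i → Controls2 D j i) ×
  (∀ j k → j ≢ i → k ≢ i → j ≢ k → Controls1 D j k)

controls1? : ∀ D i j → Dec (Controls1 D i j)
controls1? D i j =
  (_ ≟ℕ _) ×-dec (_ ≟ℕ _) ×-dec (_ ≟ℕ _) ×-dec (_ ≟ℕ _) ×-dec (_ ≟ℕ _)

controls2? : ∀ D i j → Dec (Controls2 D i j)
controls2? D i j = (_ ≟ℕ _) ×-dec ¬? (_ ≟ℕ _) ×-dec ¬? (_ ≟ℕ _)

conclusion? : ∀ D → Dec (Conclusion D)
conclusion? D = any? λ i →
  (all? λ j → ¬? (j ≟ i) →-dec controls2? D j i) ×-dec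
  (all? λ j → all? λ k →
    ¬? (j ≟ i) →-dec ¬? (k ≟ i) →-dec ¬? (j ≟ k) →-dec controls1? D j k)

-- Partially known digraphs.

Vertex : Set
Vertex = Fin 10

vertex : Fin 5 → Fin 2 → Vertex
vertex = combine

part : Vertex → Fin 5
part = quotient 2

side : Vertex → Fin 2
side = remainder {5} 2

-- The entry for (u , v) records whether there is an arc u → v, or that this is not yet
-- decided.  Two vertices of the same partite set have the entry  just false.
Row : ℕ → Set
Row = Vec (Maybe Bool)

Partial : Set
Partial = Vec (Row 10) 10

entry : Partial → Vertex → Vertex → Maybe Bool
entry K u v = lookup (lookup K u) v

set : Vertex → Vertex → Bool → Partial → Partial
set u v x K = updateAt K u λ r → updateAt r v λ _ → just x

orient : Vertex → Vertex → Bool → Partial → Partial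
orient u v x K = set u v x (set v u (not x) K)

-- The degree test and the growth of reachable sets.

data Load : Set where
  overfull tight slack : Load

-- The two budgets bound the true and the false entries still allowed.  For a vertex of
-- out-degree 4 they start at 4 and 6: four in-neighbours, the vertex itself and its partner.
load : ∀ {n} → Row n → ℕ → ℕ → Load
load (nothing    ∷ r) t       f       = load r t f
load (just true  ∷ r) zero    f       = overfull
load (just true  ∷ r) (suc t) f       = load r t f
load (just false ∷ r) t       zero    = overfull
load (just false ∷ r) t       (suc f) = load r t f
load []               zero    f       = tight
load []               (suc t) zero    = tight
load []               (suc t) (suc f) = slack

firstOpen : ∀ {n} → Row n → Maybe (Fin n)
firstOpen []            = nothing
firstOpen (nothing ∷ r) = just zero
firstOpen (just _  ∷ r) with firstOpen r
... | nothing = nothing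
... | just i  = just (suc i)

data Link : Set where
  linked unlinked : Link
  undecided       : Vertex → Link

link : Partial → Bool → List Vertex → Vertex → Link
link′ : Partial → Maybe Bool → Bool → Vertex → List Vertex → Vertex → Link
link K b []       y = unlinked
link K b (x ∷ xs) y = link′ K (entry K x y) b x xs y

link′ K nothing      b     x xs y with link K b xs y
... | linked = linked
... | _      = undecided x
link′ K (just true)  true  x xs y = linked
link′ K (just true)  false x xs y = link K false xs y
link′ K (just false) true  x xs y = link K true xs y
link′ K (just false) false x xs y = linked

data Probe : Set where
  reached : Vertex → List Vertex → Probe
  ask     : Vertex → Vertex → Probe
  blocked : Probe

-- A vertex joined by a known arc, anywhere in the list, takes precedence over a question, so
-- branching happens only when the known arcs no longer enlarge the set.
probe : Partial → Bool → List Vertex → List Vertex → Probe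
probe K b xs []       = blocked
probe K b xs (y ∷ ys) with link K b xs y
... | linked = reached y ys
... | unlinked with probe K b xs ys
...   | reached z zs = reached z (y ∷ zs)
...   | ask u v      = ask u v
...   | blocked      = blocked
probe K b xs (y ∷ ys) | undecided x with probe K b xs ys
...   | reached z zs = reached z (y ∷ zs)
...   | ask u v      = ask x y
...   | blocked      = ask x y

-- The vertices inside are known to be reachable from the root (direction true) or to reach
-- it (direction false), and those outside are still to be shown so.  The arc wanted from an
-- inside x to an outside y is  entry x y = just direction: just false means y → x.
record Goal : Set where
  constructor goal
  field
    direction : Bool
    inside    : List Vertex
    outside   : List Vertex

-- The default `false` is harmless: the digraph is relied on only together with the test that every
-- entry is known.
digraphOf : Partial → Digraph
digraphOf K i a j b = fromMaybe false (entry K (vertex i a) (vertex j b))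

finished? : ∀ K → Dec ((∀ u v → T (is-just (entry K u v))) × Conclusion (digraphOf K))
finished? K = (all? λ u → all? λ v → T? _) ×-dec conclusion? (digraphOf K)

-- The first argument is fuel, the second a list of vertices whose degree constraint should be
-- inspected, and the third the goals of each partition not yet excluded.  An arc that the
-- degrees force is also branched on: its wrong orientation is rejected in the next step.
search : ℕ → List Vertex → List (List Goal) → Partial → Bool
branch : ℕ → Vertex → Vertex → List Vertex → List (List Goal) → Partial → Bool

-- Running out of fuel counts as failure, so the 1000 in `run` only has to be large enough for the
-- search to succeed.
search zero _ _ _ = false
search (suc n) (u ∷ us) gss K with load (lookup K u) 4 6
... | overfull = true
... | slack    = search n us gss K
... | tight    with firstOpen (lookup K u)
...   | nothing = search n us gss K
...   | just v  = branch n u v us gss K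
search (suc n) [] [] K = isYes (finished? K)
-- All four goals of one partition are attained, which contradicts the absence of a strong
-- partition.
search (suc n) [] ([] ∷ gss) K = true
search (suc n) [] ((goal b xs [] ∷ gs) ∷ gss) K = search n [] (gs ∷ gss) K
search (suc n) [] ((goal b xs ys@(_ ∷ _) ∷ gs) ∷ gss) K with probe K b xs ys
... | reached z zs = search n [] ((goal b (z ∷ xs) zs ∷ gs) ∷ gss) K
... | ask u v      = branch n u v [] ((goal b xs ys ∷ gs) ∷ gss) K
... | blocked      = search n [] gss K

branch n u v us gss K =
  search n (u ∷ v ∷ us) gss (orient u v true K) ∧
  search n (u ∷ v ∷ us) gss (orient u v false K)

-- Goals and starting positions.

others : (Fin 5 → Fin 2) → Fin 4 → Vertex
others c j = vertex (suc j) (c (suc j))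

tourGoal : Bool → (Fin 5 → Fin 2) → Goal
tourGoal b c = goal b (vertex zero (c zero) ∷ []) (tabulate (others c))

-- A tournament is strong once a root reaches every vertex and is reached from every vertex; hence
-- two goals for each of the two tournaments.
goals : (Fin 5 → Fin 2) → List Goal
goals c = tourGoal true c ∷ tourGoal false c ∷ tourGoal true (flip2 ∘ c) ∷ tourGoal false (flip2 ∘ c) ∷ []

-- The choice in the first partite set is fixed, since exchanging the two tournaments gives the same
-- partition; 16 partitions remain.
choices : List (Fin 5 → Fin 2)
choices = map (λ { (a , b , c , d) → lookup (zero ∷ a ∷ b ∷ c ∷ d ∷ []) })
  (cartesianProduct (allFin 2) (cartesianProduct (allFin 2) (cartesianProduct (allFin 2) (allFin 2))))

blank-entry : Vertex → Vertex → Maybe Bool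
blank-entry u v = if does (part u ≟ part v) then just false else nothing

blank : Partial
blank = Vec.tabulate λ u → Vec.tabulate (blank-entry u)

-- The j-th entry is the number of arcs from v_{1,1} to the (j+2)-nd partite set (j from 0).
Pattern : Set
Pattern = Vec (Fin 3) 4

beats : Pattern → Fin 4 → Fin 2 → Bool
beats p j b = toℕ b <ᵇ toℕ (lookup p j)

record-first-row : Pattern → List (Fin 4 × Fin 2) → Partial
record-first-row p []             = blank
record-first-row p ((j , b) ∷ as) =
  orient (vertex zero zero) (vertex (suc j) b) (beats p j b) (record-first-row p as)

first-row-arcs : List (Fin 4 × Fin 2)
first-row-arcs = cartesianProduct (allFin 4) (allFin 2)

start : Pattern → Partial
start p = record-first-row p first-row-arcs

run : Pattern → Bool
run p = search 1000 [] (map goals choices) (start p)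

-- The sorted sequences of four numbers from 0 to 2 whose sum is the out-degree 4.
patterns : List Pattern
patterns = (1F ∷ 1F ∷ 1F ∷ 1F ∷ []) ∷ (0F ∷ 1F ∷ 1F ∷ 2F ∷ []) ∷ (0F ∷ 0F ∷ 2F ∷ 2F ∷ []) ∷ []

-- An undecided entry carries the antisymmetry that branching on it needs, so that it cannot
-- belong to two vertices of the same partite set.
Fits : Bool → Bool → Maybe Bool → Set
Fits x y nothing  = y ≡ not x
Fits x y (just z) = x ≡ z

-- Soundness of the single search steps.

updateAt-preserves : ∀ {A : Set} {n} (P : Fin n → A → Set) (xs : Vec A n) k {f} →
  P k (f (lookup xs k)) → (∀ i → P i (lookup xs i)) → ∀ i → P i (lookup (updateAt xs k f) i)
updateAt-preserves P (x ∷ xs) zero    p ps zero    = p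
updateAt-preserves P (x ∷ xs) zero    p ps (suc i) = ps (suc i)
updateAt-preserves P (x ∷ xs) (suc k) p ps zero    = ps zero
updateAt-preserves P (x ∷ xs) (suc k) p ps (suc i) =
  updateAt-preserves (P ∘ suc) xs k p (ps ∘ suc) i

trues falses : ∀ {n} → (Fin n → Bool) → ℕ
trues  g = sum λ i → b2n (g i)
falses g = sum λ i → b2n (not (g i))

-- A known entry agrees with `g`, so each charge to a budget uses up one of the true or false values
-- that the budget bounds.
load-sound : ∀ {n} (g h : Fin n → Bool) t f (r : Row n) → trues g ≤ t → falses g ≤ f →
  (∀ i → Fits (g i) (h i) (lookup r i)) → load r t f ≢ overfull
load-sound g h t       f       (nothing ∷ r)    p q fit =
  load-sound (g ∘ suc) (h ∘ suc) t f r
    (m+n≤o⇒n≤o (b2n (g zero)) p) (m+n≤o⇒n≤o (b2n (not (g zero))) q) (fit ∘ suc)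
load-sound g h t       f       (just true ∷ r)  p q fit with g zero | fit zero
load-sound g h zero    f       (just true ∷ r)  () q fit | true | refl
load-sound g h (suc t) f       (just true ∷ r)  p q fit | true | refl =
  load-sound (g ∘ suc) (h ∘ suc) t f r (s≤s⁻¹ p) q (fit ∘ suc)
load-sound g h t       f       (just false ∷ r) p q fit with g zero | fit zero
load-sound g h t       zero    (just false ∷ r) p () fit | false | refl
load-sound g h t       (suc f) (just false ∷ r) p q fit | false | refl =
  load-sound (g ∘ suc) (h ∘ suc) t f r p (s≤s⁻¹ q) (fit ∘ suc)
load-sound g h zero    f       []               _ _ _ ()
load-sound g h (suc t) zero    []               _ _ _ ()
load-sound g h (suc t) (suc f) []               _ _ _ ()

firstOpen-sound : ∀ {n} (r : Row n) {i} → firstOpen r ≡ just i → lookup r i ≡ nothing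
firstOpen-sound (nothing ∷ r) refl = refl
firstOpen-sound (just _  ∷ r) eq with firstOpen r in eq′
firstOpen-sound (just _  ∷ r) refl | just i = firstOpen-sound r eq′

data LinkSound (K : Partial) (b : Bool) (xs : List Vertex) (y : Vertex) : Link → Set where
  linked    : Any (λ x → entry K x y ≡ just b) xs → LinkSound K b xs y linked
  unlinked  : LinkSound K b xs y unlinked
  undecided : ∀ {x} → entry K x y ≡ nothing → LinkSound K b xs y (undecided x)

weaken : ∀ {K b x xs y l} → LinkSound K b xs y l → LinkSound K b (x ∷ xs) y l
weaken (linked a)    = linked (there a)
weaken unlinked      = unlinked
weaken (undecided e) = undecided e

link-sound : ∀ K b xs y → LinkSound K b xs y (link K b xs y)
link-sound K b []       y = unlinked
link-sound K b (x ∷ xs) y with entry K x y in eq | link-sound K b xs y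
link-sound K true  (x ∷ xs) y | just true  | _ = linked (here eq)
link-sound K false (x ∷ xs) y | just false | _ = linked (here eq)
link-sound K true  (x ∷ xs) y | just false | s = weaken s
link-sound K false (x ∷ xs) y | just true  | s = weaken s
link-sound K b (x ∷ xs) y | nothing | s with link K b xs y | s
... | linked      | linked a = linked (there a)
... | unlinked    | _        = undecided eq
... | undecided _ | _        = undecided eq

data ProbeSound (K : Partial) (b : Bool) (xs ys : List Vertex) : Probe → Set where
  reached : ∀ {z zs} → z ∷ zs ↭ ys → Any (λ x → entry K x z ≡ just b) xs →
            ProbeSound K b xs ys (reached z zs)
  ask     : ∀ {u v} → entry K u v ≡ nothing → ProbeSound K b xs ys (ask u v)
  blocked : ProbeSound K b xs ys blocked

probe-sound : ∀ K b xs ys → ProbeSound K b xs ys (probe K b xs ys)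
probe-sound K b xs []       = blocked
probe-sound K b xs (y ∷ ys) with link K b xs y | link-sound K b xs y
... | linked      | linked a    = reached ↭-refl a
... | unlinked    | _ with probe K b xs ys | probe-sound K b xs ys
...   | reached z zs | reached p a = reached (↭-trans (swap z y ↭-refl) (prep y p)) a
...   | ask _ _      | ask e       = ask e
...   | blocked      | blocked     = blocked
probe-sound K b xs (y ∷ ys) | undecided x | undecided e with probe K b xs ys | probe-sound K b xs ys
...   | reached z zs | reached p a = reached (↭-trans (swap z y ↭-refl) (prep y p)) a
...   | ask _ _      | _           = ask e
...   | blocked      | _           = ask e

-- Soundness of the search.

module Soundness
  (G : Vertex → Vertex → Bool)
  (four-out : ∀ u → trues (G u) ≤ 4) (six-not-out : ∀ u → falses (G u) ≤ 6)
  where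

  Witness : Set
  Witness = ∃ λ D → (∀ i a j b → D i a j b ≡ G (vertex i a) (vertex j b)) × Conclusion D

  Models : Partial → Set
  Models K = ∀ u v → Fits (G u v) (G v u) (entry K u v)

  -- Not all goals in the list can be attained; P is the attained set of vertices.
  Refuted : List Goal → Set₁
  Refuted []                   = Lift _ ⊥
  Refuted (goal b xs ys ∷ gs) = Σ[ P ∈ (Vertex → Set) ]
    All P xs × (∀ x → P x → All (λ y → G x y ≡ b → P y) ys) × (All P ys → Refuted gs)

  set-models : ∀ K {u v x} → G u v ≡ x → Models K → Models (set u v x K)
  set-models K {u} {v} {x} e m =
    updateAt-preserves (λ u r → ∀ v → Fits (G u v) (G v u) (lookup r v)) K u
      (updateAt-preserves (λ v → Fits (G u v) (G v u)) (lookup K u) v e (m u)) m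

  orient-models : ∀ K {u v x} → G v u ≡ not (G u v) → G u v ≡ x → Models K → Models (orient u v x K)
  orient-models K {u} {v} {x} anti e m =
    set-models (set v u (not x) K) e (set-models K (trans anti (cong not e)) m)

  Fits-nothing : ∀ K {u v} → Models K → entry K u v ≡ nothing → G v u ≡ not (G u v)
  Fits-nothing K {u = u} {v} m e = subst (Fits _ _) e (m u v)

  Fits-just : ∀ K {u v x} → Models K → entry K u v ≡ just x → G u v ≡ x
  Fits-just K {u = u} {v} m e = subst (Fits _ _) e (m u v)

  finished-sound : ∀ K → Models K → (∀ u v → T (is-just (entry K u v))) × Conclusion (digraphOf K) → Witness
  finished-sound K m (known , c) = digraphOf K , agrees , c
    where
    agrees : ∀ i a j b → digraphOf K i a j b ≡ G (vertex i a) (vertex j b)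
    agrees i a j b with entry K (vertex i a) (vertex j b)
      | known (vertex i a) (vertex j b) | m (vertex i a) (vertex j b)
    ... | just x | _ | e = sym e

  -- Induction on the fuel, following the one path of the search tree whose orientations agree with
  -- `G`. It ends in a contradiction or in a completely known digraph, which then agrees with `G`.
  search-sound : ∀ n us gss K → Models K → All Refuted gss → T (search n us gss K) → Witness
  branch-sound : ∀ n u v us gss K → Models K → All Refuted gss → entry K u v ≡ nothing →
    T (branch n u v us gss K) → Witness

  search-sound (suc n) (u ∷ us) gss K m rs with load (lookup K u) 4 6 in eq
  ... | overfull = λ _ → ⊥-elim
    (load-sound (G u) (λ v → G v u) 4 6 (lookup K u) (four-out u) (six-not-out u) (m u) eq)
  ... | slack    = search-sound n us gss K m rs
  ... | tight    with firstOpen (lookup K u) in eq′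
  ...   | nothing = search-sound n us gss K m rs
  ...   | just v  = branch-sound n u v us gss K m rs (firstOpen-sound (lookup K u) eq′)
  search-sound (suc n) [] [] K m rs t = finished-sound K m (toWitness {a? = finished? K} t)
  search-sound (suc n) [] ([] ∷ gss) K m (lift () ∷ rs)
  search-sound (suc n) [] ((goal b xs [] ∷ gs) ∷ gss) K m ((P , _ , _ , r) ∷ rs) =
    search-sound n [] (gs ∷ gss) K m (r [] ∷ rs)
  search-sound (suc n) [] ((goal b xs ys@(_ ∷ _) ∷ gs) ∷ gss) K m ((P , ps , cl , r) ∷ rs)
    with probe K b xs ys | probe-sound K b xs ys
  ... | ask u v | ask e = branch-sound n u v [] _ K m ((P , ps , cl , r) ∷ rs) e
  -- A cut only discards an assumption: the remaining partitions are still refuted.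
  ... | blocked | _     = search-sound n [] gss K m rs
  ... | reached z zs | reached p a =
    search-sound n [] _ K m
      ((P , Pz ∷ ps , (λ x px → All.tail (cl′ x px)) , λ pzs → r (All-resp-↭ p (Pz ∷ pzs))) ∷ rs)
    where
    cl′ : ∀ x → P x → All (λ y → G x y ≡ b → P y) (z ∷ zs)
    cl′ x px = All-resp-↭ (↭-sym p) (cl x px)
    Pz : P z
    -- The known arc joins `z` to an inside vertex, which lies in `P`; closure puts `z` into `P`.
    Pz with px , e ← All.lookupAny ps a = All.head (cl′ _ px) (Fits-just K m e)

  branch-sound n u v us gss K m rs e t with Equivalence.to T-∧ t
  ... | t₁ , t₂ with G u v in eq
  ...   | true  = search-sound n (u ∷ v ∷ us) gss _ (orient-models K (Fits-nothing K m e) eq m) rs t₁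
  ...   | false = search-sound n (u ∷ v ∷ us) gss _ (orient-models K (Fits-nothing K m e) eq m) rs t₂

-- From the given digraph to the search.

-- Consecutive pairs of vertices form the partite sets; the `+ 0` is the one that unfolding `outIn`
-- produces, so the result matches `outDeg`.
sum-pairs : ∀ n (f : Fin (n * 2) → ℕ) →
  sum {n * 2} f ≡ sum {n} λ i → f (combine {n} {2} i zero) + (f (combine {n} {2} i (suc zero)) + 0)
sum-pairs zero    f = refl
sum-pairs (suc n) f = begin
  f zero + (f (suc zero) + sum {n * 2} (λ i → f (suc (suc i))))
    ≡⟨ cong₂ (λ y s → f zero + (y + s)) (sym (+-identityʳ _)) (sum-pairs n λ i → f (suc (suc i))) ⟩
  f zero + (f (suc zero) + 0 + _)
    ≡⟨ +-assoc (f zero) _ _ ⟨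
  f zero + (f (suc zero) + 0) + _ ∎
  where open ≡-Reasoning

falses+trues : ∀ {n} (g : Fin n → Bool) → falses g + trues g ≡ n
falses+trues {zero}  g = refl
falses+trues {suc n} g with g zero
... | true  = trans (+-suc _ _) (cong suc (falses+trues (g ∘ suc)))
... | false = cong suc (falses+trues (g ∘ suc))

Reach-trans : ∀ {E x y z} → Reach E x y → Reach E y z → Reach E x z
Reach-trans here       q = q
Reach-trans (step e p) q = step e (Reach-trans p q)

module Bridge (D : Digraph) (tournament : IsMultipartiteTournament D)
  (four : ∀ i a → outDeg D i a ≡ 4) (no-strong : ¬ HasStrongPartition D) where

  arc : Fin 5 × Fin 2 → Fin 5 × Fin 2 → Bool
  arc (i , a) (j , b) = D i a j b

  G : Vertex → Vertex → Bool
  G u v = arc (remQuot 2 u) (remQuot 2 v)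

  G-vertex : ∀ i a j b → G (vertex i a) (vertex j b) ≡ D i a j b
  G-vertex i a j b = cong₂ arc (remQuot-combine i a) (remQuot-combine j b)

  trues-G : ∀ u → trues (G u) ≡ 4
  trues-G u = begin
    trues (G u)
      ≡⟨ sum-pairs 5 (b2n ∘ G u) ⟩
    sum (λ j → b2n (G u (vertex j zero)) + (b2n (G u (vertex j (suc zero))) + 0))
      ≡⟨ sum-cong-≗ (λ j → cong₂ (λ x y → b2n x + (b2n y + 0)) (arc-to j zero) (arc-to j (suc zero))) ⟩
    outDeg D (part u) (side u)
      ≡⟨ four _ _ ⟩
    4 ∎
    where
    open ≡-Reasoning
    arc-to : ∀ j b → G u (vertex j b) ≡ arc (remQuot 2 u) (j , b)
    arc-to j b = cong (arc (remQuot 2 u)) (remQuot-combine j b)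

  falses-G : ∀ u → falses (G u) ≡ 6
  falses-G u = +-cancelʳ-≡ 4 _ _ (trans (cong (falses (G u) +_) (sym (trues-G u))) (falses+trues (G u)))

  open Soundness G (≤-reflexive ∘ trues-G) (≤-reflexive ∘ falses-G) public

  Reached : Bool → (Fin 5 → Fin 2) → Fin 5 → Set
  Reached true  c i = Reach (induced D c) zero i
  Reached false c i = Reach (induced D c) i zero

  Reached-zero : ∀ b c → Reached b c zero
  Reached-zero true  c = here
  Reached-zero false c = here

  Reached-step : ∀ b c i j → D i (c i) j (c j) ≡ b → Reached b c i → Reached b c j
  Reached-step true  c i j e r = Reach-trans r (step (subst T (sym e) tt) here)
  Reached-step false c i j e r with i ≟ j
  -- The absence of an arc from `i` to `j` yields the reverse arc only between different partite
  -- sets; for `i = j` nothing has to be shown.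
  ... | yes refl = r
  ... | no  i≢j  = step (subst T (sym (trans (proj₂ tournament i _ j _ i≢j) (cong not e))) tt) r

  -- Take for `P` the vertices of the tournament that the root reaches, or that reach the root; one
  -- more arc in the given direction stays in `P`.
  tourGoal-refuted : ∀ b c {gs} → ((∀ i → Reached b c i) → Refuted gs) → Refuted (tourGoal b c ∷ gs)
  tourGoal-refuted b c r = P , start∈P ∷ [] , closed , λ all → r λ
      { zero    → Reached-zero b c
      ; (suc j) → fromP (suc j) (tabulate⁻ {f = others c} all j)
      }
    where
    P : Vertex → Set
    P u = ∃ λ i → u ≡ vertex i (c i) × Reached b c i

    start∈P : P (vertex zero (c zero))
    start∈P = zero , refl , Reached-zero b c

    closed : ∀ x → P x → All (λ y → G x y ≡ b → P y) (tabulate (others c))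
    closed _ (i , refl , p) = tabulate⁺ λ j e →
      suc j , refl , Reached-step b c i (suc j) (trans (sym (G-vertex i _ (suc j) _)) e) p

    fromP : ∀ i → P (vertex i (c i)) → Reached b c i
    fromP i (i′ , e , p) = subst (Reached b c) (sym (combine-injectiveˡ i (c i) i′ (c i′) e)) p

  goals-refuted : ∀ c → Refuted (goals c)
  goals-refuted c =
    tourGoal-refuted true  c λ to → tourGoal-refuted false c λ from →
    tourGoal-refuted true (flip2 ∘ c) λ to′ → tourGoal-refuted false (flip2 ∘ c) λ from′ →
    -- Any two vertices are joined by a path through the root.
    lift (no-strong (c , (λ x y → Reach-trans (from x) (to y)) , λ x y → Reach-trans (from′ x) (to′ y)))

  vertex-antisym : ∀ i a j b → i ≢ j → G (vertex j b) (vertex i a) ≡ not (G (vertex i a) (vertex j b))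
  vertex-antisym i a j b i≢j = begin
    G (vertex j b) (vertex i a)       ≡⟨ G-vertex j b i a ⟩
    D j b i a                         ≡⟨ proj₂ tournament i a j b i≢j ⟩
    not (D i a j b)                   ≡⟨ cong not (G-vertex i a j b) ⟨
    not (G (vertex i a) (vertex j b)) ∎
    where open ≡-Reasoning

  blank-models : Models blank
  blank-models u v = subst (Fits (G u v) (G v u)) (sym entry-blank) fits
    where
    entry-blank : entry blank u v ≡ blank-entry u v
    entry-blank = trans (cong (λ r → lookup r v) (lookup∘tabulate (λ u → Vec.tabulate (blank-entry u)) u))
      (lookup∘tabulate (blank-entry u) v)

    fits : Fits (G u v) (G v u) (blank-entry u v)
    fits with part u ≟ part v
    ... | yes e = trans (cong (λ j → D (part u) (side u) j (side v)) (sym e))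
      (proj₁ tournament (part u) (side u) (side v))
    ... | no  n = proj₂ tournament (part u) (side u) (part v) (side v) n

  module _ (p : Pattern) (first-row : ∀ j b → D zero zero (suc j) b ≡ beats p j b) where

    record-first-row-models : ∀ as → Models (record-first-row p as)
    record-first-row-models []             = blank-models
    record-first-row-models ((j , b) ∷ as) =
      orient-models (record-first-row p as) {vertex zero zero} {vertex (suc j) b}
        (vertex-antisym zero zero (suc j) b λ ())
        (trans (G-vertex zero zero (suc j) b) (first-row j b))
        (record-first-row-models as)

    run-sound : run p ≡ true → Witness
    run-sound e = search-sound 1000 [] (map goals choices) (start p)
      (record-first-row-models first-row-arcs) (All-map⁺ (All.universal goals-refuted choices)) (subst T (sym e) tt)

-- Relabelling partite sets and their vertices.

twist : Bool → Fin 2 → Fin 2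
twist false a = a
twist true  a = flip2 a

twist-flip2 : ∀ x a → flip2 (twist x a) ≡ twist x (flip2 a)
twist-flip2 false a = refl
twist-flip2 true  a = refl

twist-sum : ∀ x (f : Fin 2 → ℕ) → f (twist x zero) + (f (twist x (suc zero)) + 0) ≡ f zero + (f (suc zero) + 0)
twist-sum false f = refl
twist-sum true  f = begin
  f (suc zero) + (f zero + 0) ≡⟨ cong (f (suc zero) +_) (+-identityʳ _) ⟩
  f (suc zero) + f zero       ≡⟨ +-comm (f (suc zero)) _ ⟩
  f zero + f (suc zero)       ≡⟨ cong (f zero +_) (+-identityʳ _) ⟨
  f zero + (f (suc zero) + 0) ∎
  where open ≡-Reasoning

twist-× : ∀ x (Q : Fin 2 → Set) → Q (twist x zero) → Q (twist x (suc zero)) → Q zero × Q (suc zero)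
twist-× false Q p q = p , q
twist-× true  Q p q = q , p

Reach-map : ∀ {E F} (f : Fin 5 → Fin 5) → (∀ x y → T (E x y) → T (F (f x) (f y))) →
  ∀ {x y} → Reach E x y → Reach F (f x) (f y)
Reach-map f g here       = here
Reach-map f g (step e p) = step (g _ _ e) (Reach-map f g p)

-- The pointwise equation also covers digraphs that merely agree entry by entry, through the
-- identity relabelling.
module Relabelling (π : Permutation′ 5) (s : Fin 5 → Bool) {D D′ : Digraph}
  (relabels : ∀ i a j b → D′ i a j b ≡ D (π ⟨$⟩ʳ i) (twist (s i) a) (π ⟨$⟩ʳ j) (twist (s j) b)) where

  outIn-relabel : ∀ i a j → outIn D′ i a j ≡ outIn D (π ⟨$⟩ʳ i) (twist (s i) a) (π ⟨$⟩ʳ j)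
  outIn-relabel i a j = trans
    (cong₂ (λ x y → b2n x + (b2n y + 0)) (relabels i a j zero) (relabels i a j (suc zero)))
    (twist-sum (s j) λ b → b2n (D (π ⟨$⟩ʳ i) (twist (s i) a) (π ⟨$⟩ʳ j) b))

  arcsFrom-relabel : ∀ i j → arcsFrom D′ i j ≡ arcsFrom D (π ⟨$⟩ʳ i) (π ⟨$⟩ʳ j)
  arcsFrom-relabel i j = trans
    (cong₂ (λ x y → x + (y + 0)) (outIn-relabel i zero j) (outIn-relabel i (suc zero) j))
    (twist-sum (s i) λ a → outIn D (π ⟨$⟩ʳ i) a (π ⟨$⟩ʳ j))

  outDeg-relabel : ∀ i a → outDeg D′ i a ≡ outDeg D (π ⟨$⟩ʳ i) (twist (s i) a)
  outDeg-relabel i a = trans (sum-cong-≗ (outIn-relabel i a))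
    (sym (sum-permute (outIn D (π ⟨$⟩ʳ i) (twist (s i) a)) π))

  outIn-transfer : (Q : ℕ → Set) → ∀ i j → Q (outIn D′ i zero j) → Q (outIn D′ i (suc zero) j) →
    Q (outIn D (π ⟨$⟩ʳ i) zero (π ⟨$⟩ʳ j)) × Q (outIn D (π ⟨$⟩ʳ i) (suc zero) (π ⟨$⟩ʳ j))
  outIn-transfer Q i j p q = twist-× (s i) (λ a → Q (outIn D (π ⟨$⟩ʳ i) a (π ⟨$⟩ʳ j)))
    (subst Q (outIn-relabel i zero j) p) (subst Q (outIn-relabel i (suc zero) j) q)

  controls1-transfer : ∀ i j → Controls1 D′ i j → Controls1 D (π ⟨$⟩ʳ i) (π ⟨$⟩ʳ j)
  controls1-transfer i j (n , p , q , p′ , q′) =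
    let (r  , s)  = outIn-transfer (_≡ 1) i j p q
        (r′ , s′) = outIn-transfer (_≡ 1) j i p′ q′
    in trans (sym (arcsFrom-relabel i j)) n , r , s , r′ , s′

  controls2-transfer : ∀ i j → Controls2 D′ i j → Controls2 D (π ⟨$⟩ʳ i) (π ⟨$⟩ʳ j)
  controls2-transfer i j (n , p , q) =
    trans (sym (arcsFrom-relabel i j)) n , outIn-transfer (_≢ 1) j i p q

  conclusion-transfer : Conclusion D′ → Conclusion D
  conclusion-transfer (i , c2 , c1) = π ⟨$⟩ʳ i
    , (λ j j≢πi → subst (λ j → Controls2 D j (π ⟨$⟩ʳ i)) (inverseʳ π)
        (controls2-transfer _ i (c2 _ (unmoved j≢πi))))
    , (λ j k j≢πi k≢πi j≢k → subst₂ (Controls1 D) (inverseʳ π) (inverseʳ π)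
        (controls1-transfer _ _ (c1 _ _ (unmoved j≢πi) (unmoved k≢πi)
          λ e → j≢k (trans (sym (inverseʳ π)) (trans (cong (π ⟨$⟩ʳ_) e) (inverseʳ π))))))
    where
    unmoved : ∀ {j} → j ≢ π ⟨$⟩ʳ i → π ⟨$⟩ˡ j ≢ i
    unmoved j≢πi e = j≢πi (trans (sym (inverseʳ π)) (cong (π ⟨$⟩ʳ_) e))

  stronglyConnected-transfer : ∀ {c c′ : Fin 5 → Fin 2} → (∀ i → c (π ⟨$⟩ʳ i) ≡ twist (s i) (c′ i)) →
    StronglyConnected (induced D′ c′) → StronglyConnected (induced D c)
  stronglyConnected-transfer {c} {c′} eq strong x y =
    subst₂ (Reach (induced D c)) (inverseʳ π) (inverseʳ π)
      (Reach-map (π ⟨$⟩ʳ_) (λ i j → subst T (same i j)) (strong (π ⟨$⟩ˡ x) (π ⟨$⟩ˡ y)))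
    where
    same : ∀ i j → induced D′ c′ i j ≡ induced D c (π ⟨$⟩ʳ i) (π ⟨$⟩ʳ j)
    same i j = trans (relabels i (c′ i) j (c′ j))
      (cong₂ (λ a b → D (π ⟨$⟩ʳ i) a (π ⟨$⟩ʳ j) b) (sym (eq i)) (sym (eq j)))

  strongPartition-transfer : HasStrongPartition D′ → HasStrongPartition D
  strongPartition-transfer (c′ , p , q) = c
    , stronglyConnected-transfer c-π p
    , stronglyConnected-transfer (λ i → trans (cong flip2 (c-π i)) (twist-flip2 (s i) (c′ i))) q
    where
    c : Fin 5 → Fin 2
    c k = twist (s (π ⟨$⟩ˡ k)) (c′ (π ⟨$⟩ˡ k))

    c-π : ∀ i → c (π ⟨$⟩ʳ i) ≡ twist (s i) (c′ i)
    c-π i = cong (λ k → twist (s k) (c′ k)) (inverseˡ π)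

  tournament-transfer : IsMultipartiteTournament D → IsMultipartiteTournament D′
  tournament-transfer (irrefl , antisym) =
    (λ i a b → trans (relabels i a i b) (irrefl _ _ _)) ,
    (λ i a j b i≢j → trans (relabels j b i a)
      (trans (antisym _ _ _ _ λ e → i≢j (trans (sym (inverseˡ π)) (trans (cong (π ⟨$⟩ˡ_) e) (inverseˡ π))))
        (cong not (sym (relabels i a j b)))))

-- Degrees and the pattern at v_{1,1}.

outIn+inFrom : ∀ D → IsMultipartiteTournament D → ∀ i a j →
  outIn D i a j + inFrom D i a j ≡ (if does (i ≟ j) then 0 else 2)
outIn+inFrom D (irrefl , antisym) i a j with i ≟ j
... | yes refl rewrite irrefl i a zero | irrefl i a (suc zero) | irrefl i zero a | irrefl i (suc zero) a = refl
... | no i≢j rewrite antisym i a j zero i≢j | antisym i a j (suc zero) i≢j with D i a j zero | D i a j (suc zero)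
...   | true  | true  = refl
...   | true  | false = refl
...   | false | true  = refl
...   | false | false = refl

-- Out-degree and in-degree add up to 8, two for each of the four other partite sets, and regularity
-- makes them equal.
outDeg≡4 : ∀ D → IsMultipartiteTournament D → IsRegular D → ∀ i a → outDeg D i a ≡ 4
outDeg≡4 D tournament regular i a = *-cancelˡ-≡ _ 4 2 (begin
  outDeg D i a + (outDeg D i a + 0)
    ≡⟨ cong (outDeg D i a +_) (trans (+-identityʳ _) (regular i a)) ⟩
  outDeg D i a + inDeg D i a
    ≡⟨ ∑-distrib-+ (outIn D i a) (inFrom D i a) ⟨
  sum (λ j → outIn D i a j + inFrom D i a j)
    ≡⟨ sum-cong-≗ (outIn+inFrom D tournament i a) ⟩
  sum (λ j → if does (i ≟ j) then 0 else 2)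
    ≡⟨ toWitness {a? = all? λ i → sum {5} (λ j → if does (i ≟ j) then 0 else 2) ≟ℕ 8} tt i ⟩
  8 ∎)
  where open ≡-Reasoning

-- Swapping a false-true pair puts the true value first; the number of true values then determines
-- the pair, in the form used by `beats`.
sort-pair : (f : Fin 2 → Bool) → ∃₂ λ x (n : Fin 3) →
  (∀ b → f (twist x b) ≡ (toℕ b <ᵇ toℕ n)) × b2n (f zero) + (b2n (f (suc zero)) + 0) ≡ toℕ n
sort-pair f with f zero in e₀ | f (suc zero) in e₁
... | true  | true  = false , 2F , (λ { zero → e₀ ; (suc zero) → e₁ }) , refl
... | true  | false = false , 1F , (λ { zero → e₀ ; (suc zero) → e₁ }) , refl
... | false | true  = true  , 1F , (λ { zero → e₁ ; (suc zero) → e₀ }) , refl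
... | false | false = false , 0F , (λ { zero → e₀ ; (suc zero) → e₁ }) , refl

-- Products of two transpositions sort every sequence in arrange.
arrangement : ∀ i j k l → Permutation′ 4
arrangement i j k l = transpose i j ∘ₚ transpose k l

arrange : (a b c d : Fin 3) → toℕ a + (toℕ b + (toℕ c + (toℕ d + 0))) ≡ 4 →
  Any (λ p → ∃ λ i → ∃ λ j → ∃ λ k → ∃ λ l → ∀ m →
    lookup (a ∷ b ∷ c ∷ d ∷ []) (arrangement i j k l ⟨$⟩ʳ m) ≡ lookup p m) patterns
arrange = toWitness {a? = all? λ a → all? λ b → all? λ c → all? λ d → (_ ≟ℕ _) →-dec
  Any.any? (λ p → any? λ i → any? λ j → any? λ k → any? λ l → all? λ m → _ ≟ _) patterns} tt

runs-succeed : All (λ p → run p ≡ true) patterns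
-- The three searches are carried out here, by evaluation during type checking.
runs-succeed = refl ∷ refl ∷ refl ∷ []

-- Reduction to the three patterns.

first-row-conclusion : ∀ D → IsMultipartiteTournament D →
  (∀ i a → outDeg D i a ≡ 4) → ¬ HasStrongPartition D →
  ∀ p → (∀ j b → D zero zero (suc j) b ≡ beats p j b) → run p ≡ true → Conclusion D
first-row-conclusion D tournament four no-strong p first-row success =
  let D′ , agrees , c = B.run-sound p first-row success
  in Relabelling.conclusion-transfer Perm.id (λ _ → false)
       (λ i a j b → trans (agrees i a j b) (B.G-vertex i a j b)) c
  where module B = Bridge D tournament four no-strong

theorem3p1 : (D : Digraph) → IsMultipartiteTournament D → IsRegular D →
    ¬ HasStrongPartition D →
    ∃ λ (i : Fin 5) →
    (∀ j → j ≢ i → Controls2 D j i) ×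
    (∀ j k → j ≢ i → k ≢ i → j ≢ k → Controls1 D j k)
theorem3p1 D tournament regular no-strong =
  All.lookupWith
    (λ { {p} success (i , j , k , l , arranged) → conclude p (arrangement i j k l) arranged success })
    runs-succeed (arrange (n 0F) (n 1F) (n 2F) (n 3F) n-sum)
  where
  four : ∀ i a → outDeg D i a ≡ 4
  four = outDeg≡4 D tournament regular

  x : Fin 4 → Bool
  x j = proj₁ (sort-pair (D zero zero (suc j)))

  n : Fin 4 → Fin 3
  n j = proj₁ (proj₂ (sort-pair (D zero zero (suc j))))

  sorted : ∀ j b → D zero zero (suc j) (twist (x j) b) ≡ (toℕ b <ᵇ toℕ (n j))
  sorted j = proj₁ (proj₂ (proj₂ (sort-pair (D zero zero (suc j)))))

  n-sum : sum (λ j → toℕ (n j)) ≡ 4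
  n-sum = begin
    sum (λ j → toℕ (n j))
      ≡⟨ sum-cong-≗ (λ j → proj₂ (proj₂ (proj₂ (sort-pair (D zero zero (suc j)))))) ⟨
    sum (λ j → outIn D zero zero (suc j))
      ≡⟨ cong₂ (λ y z → b2n y + (b2n z + 0) + sum (λ j → outIn D zero zero (suc j)))
           (proj₁ tournament zero zero zero) (proj₁ tournament zero zero (suc zero)) ⟨
    outDeg D zero zero
      ≡⟨ four zero zero ⟩
    4 ∎
    where open ≡-Reasoning

  conclude : ∀ p σ → (∀ j → lookup (Vec.tabulate n) (σ ⟨$⟩ʳ j) ≡ lookup p j) → run p ≡ true → Conclusion D
  conclude p σ arranged success = R.conclusion-transfer
    (first-row-conclusion D′ (R.tournament-transfer tournament)
      (λ i a → trans (R.outDeg-relabel i a) (four _ _)) (no-strong ∘ R.strongPartition-transfer)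
      p first-row success)
    where
    π : Permutation′ 5
    π = lift₀ σ

    s : Fin 5 → Bool
    -- The vertex v_{1,1} stays in place; every other partite set gets the sorting swap of the set
    -- of `D` that it comes from.
    s zero    = false
    s (suc j) = x (σ ⟨$⟩ʳ j)

    D′ : Digraph
    D′ i a j b = D (π ⟨$⟩ʳ i) (twist (s i) a) (π ⟨$⟩ʳ j) (twist (s j) b)

    module R = Relabelling π s {D} {D′} (λ _ _ _ _ → refl)

    first-row : ∀ j b → D′ zero zero (suc j) b ≡ beats p j b
    first-row j b = trans (sorted (σ ⟨$⟩ʳ j) b)
      (cong (λ m → toℕ b <ᵇ toℕ m) (trans (sym (lookup∘tabulate n (σ ⟨$⟩ʳ j))) (arranged j)))
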